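{- For each Fishburn cover $P$ there is a unique Fishburn tree $T$ such that $\mathfrak{P}(T)=P$.
   Context: Write $[k]=\{1,\dots,k\}$. A binary tree is either empty or a triple $T=(L,r,R)$ with $r$ a node (the root) and $L,R$ binary trees (left and right subtree). $V(T)$ is the set of nodes and the size of $T$ is $|V(T)|$. A vertex labeling is a map $\mathfrak{l}:V(T)\to\{1,2,\dots\}$; $\max(T)$ is the largest label, with $\max(\emptyset)=0$. Labeled binary trees are considered up to label-preserving isomorphism of binary trees. $T$ is decreasing if it is empty, or $T=(L,r,R)$ with $L,R$ decreasing and $\mathfrak{l}(r)\ge\max\{\max(L),\max(R)\}$. $T$ is strictly decreasing to the left if it is empty, or $T=(L,r,R)$ with $\mathfrak{l}(r)>\max(L)$ and $L,R$ strictly decreasing to the left. An endotree of size $n$ is a decreasing binary tree of size $n$ that is strictly decreasing to the left and has all labels in $[n]$; it is regular if the set of its labels equals $[k]$ for some $k\le n$. The in-order traversal of $T=(L,r,R)$ traverses $L$ recursively, then visits $r$, then traverses $R$ recursively; $v_i$ is the $i$-th visited node. Put $\mathrm{asctops}(T)=\{v_1\}\cup\{v_i: v_i\text{ has a left child}\}$ and $\mathrm{nub}(T)=\{v_j:\mathfrak{l}(v_i)\ne\mathfrak{l}(v_j)\text{ for each }i<j\}$ (both empty for the empty tree). A Fishburn tree is a regular endotree $T$ with $\mathrm{nub}(T)=\mathrm{asctops}(T)$. A maximal right path is a nonempty sequence of nodes $(w_1,\dots,w_m)$ with $w_{i+1}$ the right child of $w_i$, where $w_1$ is not a right child of any node and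 $w_m$ has no right child; maximal left paths are defined analogously. $\mathrm{rpath}(v)$ and $\mathrm{lpath}(v)$ are the unique maximal right and left paths containing $v$. For nonempty $T$ with root $r$, $\mathrm{diag}(T)=\mathrm{lpath}(r)$ (viewed as a set; it is contained in $\mathrm{asctops}(T)$) and $\overline{\mathrm{diag}}(T)=\mathrm{asctops}(T)\setminus\mathrm{diag}(T)$. For a Fishburn tree $T$ with $k=\max(T)$, the set $\mathrm{asctops}(T)$ has exactly one node of each label $i\in[k]$. If $v\in\mathrm{asctops}(T)$ has label $i$, let $W_i=\mathrm{rpath}(v)$ if $v\in\mathrm{diag}(T)$, and $W_i=\mathrm{rpath}(\mathrm{lchild}(v))$ if $v\in\overline{\mathrm{diag}}(T)$, where $\mathrm{lchild}(v)$ is the left child of $v$; $W_1,\dots,W_k$ are exactly the maximal right paths of $T$. Let $B_i$ be the multiset $\{\mathfrak{l}(u):u\in W_i\}$ (labels counted with multiplicity) and $\mathfrak{P}(T)=B_1\dots B_k$. A Fishburn cover is an ordered list $P=B_1\dots B_k$ of $k$ nonempty multisets of positive integers such that the set of integers occurring in $B_1,\dots,B_k$ is exactly $[k]$, and for all $i\in[k]$, if $j\in B_i$ then $j\le i$. (For $k=0$, the empty list corresponds to the empty tree.) -}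

module Defs where

open import Data.Bool.Base using (if_then_else_)
open import Data.Empty using (⊥-elim)
open import Data.Fin.Base using (Fin; zero; suc; toℕ) renaming (_<_ to _<ᶠ_)
import Data.Fin.Properties as Fin
open import Data.List.Base using (List; []; _∷_; _++_; map; head; length; lookup; tabulate)
open import Data.List.Membership.Propositional using (_∈_; lose)
open import Data.List.Membership.Propositional.Properties using (∈-++⁺ˡ; ∈-++⁺ʳ; ∈-map⁺)
import Data.List.Membership.DecPropositional as DecMembership
open import Data.List.NonEmpty.Base using (List⁺; _∷_; toList) renaming (map to map⁺)
open import Data.List.Relation.Binary.Permutation.Propositional using (_↭_)
open import Data.List.Relation.Binary.Pointwise.Base using (Pointwise)
open import Data.List.Relation.Unary.All using (All)
open import Data.List.Relation.Unary.Any using (Any; here; there)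
open import Data.Maybe.Base using (Maybe; just; nothing; maybe′)
  renaming (map to mapᵐ)
open import Data.Maybe.Properties using (just-injective)
open import Data.Nat.Base using (ℕ; zero; suc; _≤_; _<_; _⊔_; z≤n; s≤s)
open import Data.Nat.Properties using (≤-trans; ≤-reflexive; ⊔-sel)
import Data.Nat.Properties as ℕ
open import Data.Product.Base using (_×_; _,_; ∃; proj₁; proj₂)
open import Data.Product using (∃!)
open import Data.Sum.Base using (_⊎_; inj₁; inj₂)
open import Data.Tree.Binary using (Tree; leaf; node; #nodes)
open import Data.Unit.Base using (⊤; tt)
open import Function.Base using (_∘_)
open import Function.Bundles using (_⇔_; Equivalence)
open import Relation.Binary.Definitions using (DecidableEquality; tri<; tri≈; tri>)
open import Relation.Binary.PropositionalEquality
  using (_≡_; _≢_; refl; sym; trans; cong)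
open import Relation.Nullary.Decidable using (yes; no; does; map′)
open import Relation.Nullary.Negation using (contradiction)
open import Relation.Unary using (Pred; _≐_)

infix 4 _∈[_]

_∈[_] : ℕ → ℕ → Set
i ∈[ k ] = 1 ≤ i × i ≤ k

------------------------------------------------------------------------
-- Labeled binary trees

-- The label of each node is stored at the node, so propositional equality
-- of such trees is label-preserving isomorphism.  Positivity of the labels
-- is imposed by the predicate IsEndotree.
LTree : Set
LTree = Tree ℕ ⊤

pattern ∅ = leaf tt

-- A node is the path leading to it from the root.
data Node : LTree → Set where
  root : ∀ {L n R} → Node (node L n R)
  inˡ  : ∀ {L n R} → Node L → Node (node L n R)
  inʳ  : ∀ {L n R} → Node R → Node (node L n R)

private
  variable
    T L R : LTree
    n : ℕ

label : Node T → ℕ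
label {node _ n _} root = n
label (inˡ v) = label v
label (inʳ v) = label v

inˡ-injective : {u v : Node L} → inˡ {L} {n} {R} u ≡ inˡ v → u ≡ v
inˡ-injective refl = refl

inʳ-injective : {u v : Node R} → inʳ {L} {n} {R} u ≡ inʳ v → u ≡ v
inʳ-injective refl = refl

_≟_ : DecidableEquality (Node T)
root  ≟ root  = yes refl
root  ≟ inˡ _ = no λ ()
root  ≟ inʳ _ = no λ ()
inˡ _ ≟ root  = no λ ()
inˡ u ≟ inˡ v = map′ (cong inˡ) inˡ-injective (u ≟ v)
inˡ _ ≟ inʳ _ = no λ ()
inʳ _ ≟ root  = no λ ()
inʳ _ ≟ inˡ _ = no λ ()
inʳ u ≟ inʳ v = map′ (cong inʳ) inʳ-injective (u ≟ v)

root? : ∀ T → Maybe (Node T)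
root? (leaf _)     = nothing
root? (node _ _ _) = just root

lchild : Node T → Maybe (Node T)
lchild {node L _ _} root = mapᵐ inˡ (root? L)
lchild (inˡ v) = mapᵐ inˡ (lchild v)
lchild (inʳ v) = mapᵐ inʳ (lchild v)

rchild : Node T → Maybe (Node T)
rchild {node _ _ R} root = mapᵐ inʳ (root? R)
rchild (inˡ v) = mapᵐ inˡ (rchild v)
rchild (inʳ v) = mapᵐ inʳ (rchild v)

max : LTree → ℕ
max (leaf _)     = 0
max (node L n R) = n ⊔ (max L ⊔ max R)

------------------------------------------------------------------------
-- Endotrees

Decreasing : LTree → Set
Decreasing (leaf _)     = ⊤
Decreasing (node L n R) = Decreasing L × Decreasing R × max L ⊔ max R ≤ n

StrictlyDecreasingLeft : LTree → Set
StrictlyDecreasingLeft (leaf _)     = ⊤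
StrictlyDecreasingLeft (node L n R) =
  max L < n × StrictlyDecreasingLeft L × StrictlyDecreasingLeft R

record IsEndotree (T : LTree) : Set where
  field
    decreasing         : Decreasing T
    strictlyDecreasing : StrictlyDecreasingLeft T
    labels∈[size]      : (v : Node T) → label v ∈[ #nodes T ]

Regular : LTree → Set
Regular T = ∃ λ k → k ≤ #nodes T ×
  (∀ i → (∃ λ (v : Node T) → label v ≡ i) ⇔ i ∈[ k ])

------------------------------------------------------------------------
-- Fishburn trees

inorder : ∀ T → List (Node T)
inorder (leaf _)     = []
inorder (node L _ R) = map inˡ (inorder L) ++ root ∷ map inʳ (inorder R)

AscTop : Pred (Node T) _
AscTop {T} v = head (inorder T) ≡ just v ⊎ ∃ λ u → lchild v ≡ just u

Nub : Pred (Node T) _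
Nub {T} v = ∃ λ (j : Fin (length (inorder T))) →
  lookup (inorder T) j ≡ v ×
  (∀ i → i <ᶠ j → label (lookup (inorder T) i) ≢ label v)

record IsFishburnTree (T : LTree) : Set where
  field
    isEndotree  : IsEndotree T
    regular     : Regular T
    nub≐asctops : Nub {T} ≐ AscTop {T}

------------------------------------------------------------------------
-- Maximal left and right paths

-- DescendsFrom child v vs: v ∷ vs follows child as long as possible.
data DescendsFrom (child : Node T → Maybe (Node T)) (v : Node T) : List (Node T) → Set where
  stop : child v ≡ nothing → DescendsFrom child v []
  step : ∀ {u us} → child v ≡ just u → DescendsFrom child u us →
         DescendsFrom child v (u ∷ us)

MaximalPath : (child : Node T → Maybe (Node T)) → Pred (List⁺ (Node T)) _
MaximalPath child (v ∷ vs) = (∀ u → child u ≢ just v) × DescendsFrom child v vs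

lspine rspine : ∀ T → List (Node T)
lspine (leaf _)     = []
lspine (node L _ _) = root ∷ map inˡ (lspine L)
rspine (leaf _)     = []
rspine (node _ _ R) = root ∷ map inʳ (rspine R)

-- Transport a path from the left (right) subtree to the whole tree,
-- prepending the root of the whole tree if the path starts at the root of
-- the subtree.
extendˡ : List⁺ (Node L) → List⁺ (Node (node L n R))
extendˡ (root  ∷ vs) = root ∷ inˡ root ∷ map inˡ vs
extendˡ (inˡ v ∷ vs) = inˡ (inˡ v) ∷ map inˡ vs
extendˡ (inʳ v ∷ vs) = inˡ (inʳ v) ∷ map inˡ vs

extendʳ : List⁺ (Node R) → List⁺ (Node (node L n R))
extendʳ (root  ∷ vs) = root ∷ inʳ root ∷ map inʳ vs
extendʳ (inˡ v ∷ vs) = inʳ (inˡ v) ∷ map inʳ vs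
extendʳ (inʳ v ∷ vs) = inʳ (inʳ v) ∷ map inʳ vs

-- That lpath v and rpath v are the unique maximal left and right paths
-- containing v is proved by lpath-maximal, ∈-lpath, lpath-unique and
-- rpath-maximal, ∈-rpath, rpath-unique.
lpath rpath : Node T → List⁺ (Node T)
lpath {node L _ _} root = root ∷ map inˡ (lspine L)
lpath (inˡ v) = extendˡ (lpath v)
lpath (inʳ v) = map⁺ inʳ (lpath v)
rpath {node _ _ R} root = root ∷ map inʳ (rspine R)
rpath (inˡ v) = map⁺ inˡ (rpath v)
rpath (inʳ v) = extendʳ (rpath v)

private
  module _ {A B : Set} {f : A → B} (inj : ∀ {x y} → f x ≡ f y → x ≡ y) where

    map-just⁻ : ∀ (m : Maybe A) {x} → mapᵐ f m ≡ just (f x) → m ≡ just x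
    map-just⁻ (just _) eq = cong just (inj (just-injective eq))

  map-just≢ : ∀ {A B : Set} (f : A → B) {y} → (∀ x → f x ≢ y) → ∀ m → mapᵐ f m ≢ just y
  map-just≢ f ne (just x) eq = ne x (just-injective eq)
  map-just≢ f ne nothing  ()

  map-just⁺ : ∀ {A B : Set} (f : A → B) (m : Maybe A) {y} → mapᵐ f m ≡ just y →
              ∃ λ x → m ≡ just x × f x ≡ y
  map-just⁺ f (just x) refl = x , refl , refl

  descends-map : ∀ {S T} {c : Node S → Maybe (Node S)} {d : Node T → Maybe (Node T)}
    (f : Node S → Node T) → (∀ v → d (f v) ≡ mapᵐ f (c v)) →
    ∀ {v vs} → DescendsFrom c v vs → DescendsFrom d (f v) (map f vs)
  descends-map f comm (stop eq)   = stop (trans (comm _) (cong (mapᵐ f) eq))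
  descends-map f comm (step eq d) = step (trans (comm _) (cong (mapᵐ f) eq)) (descends-map f comm d)

  lspine-descends : ∀ L n R → DescendsFrom lchild (root {L} {n} {R}) (map inˡ (lspine L))
  lspine-descends (leaf _)     n R = stop refl
  lspine-descends (node K m S) n R =
    step refl (descends-map inˡ (λ _ → refl) (lspine-descends K m S))

  rspine-descends : ∀ L n R → DescendsFrom rchild (root {L} {n} {R}) (map inʳ (rspine R))
  rspine-descends L n (leaf _)     = stop refl
  rspine-descends L n (node K m S) =
    step refl (descends-map inʳ (λ _ → refl) (rspine-descends K m S))

  root-orphanˡ : (u : Node (node L n R)) → lchild u ≢ just root
  root-orphanˡ {L = L} root    = map-just≢ inˡ (λ _ ()) (root? L)
  root-orphanˡ (inˡ u) = map-just≢ inˡ (λ _ ()) (lchild u)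
  root-orphanˡ (inʳ u) = map-just≢ inʳ (λ _ ()) (lchild u)

  root-orphanʳ : (u : Node (node L n R)) → rchild u ≢ just root
  root-orphanʳ {R = R} root    = map-just≢ inʳ (λ _ ()) (root? R)
  root-orphanʳ (inˡ u) = map-just≢ inˡ (λ _ ()) (rchild u)
  root-orphanʳ (inʳ u) = map-just≢ inʳ (λ _ ()) (rchild u)

  orphanˡˡ : {v : Node L} → root? L ≢ just v → (∀ u → lchild u ≢ just v) →
             (u : Node (node L n R)) → lchild u ≢ just (inˡ v)
  orphanˡˡ {L = L} r o root    eq = r (map-just⁻ inˡ-injective (root? L) eq)
  orphanˡˡ r o (inˡ u) eq = o u (map-just⁻ inˡ-injective (lchild u) eq)
  orphanˡˡ r o (inʳ u) eq = map-just≢ inʳ (λ _ ()) (lchild u) eq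

  orphanʳʳ : {v : Node R} → root? R ≢ just v → (∀ u → rchild u ≢ just v) →
             (u : Node (node L n R)) → rchild u ≢ just (inʳ v)
  orphanʳʳ {R = R} r o root    eq = r (map-just⁻ inʳ-injective (root? R) eq)
  orphanʳʳ r o (inʳ u) eq = o u (map-just⁻ inʳ-injective (rchild u) eq)
  orphanʳʳ r o (inˡ u) eq = map-just≢ inˡ (λ _ ()) (rchild u) eq

  orphanˡʳ : {v : Node R} → (∀ u → lchild u ≢ just v) →
             (u : Node (node L n R)) → lchild u ≢ just (inʳ v)
  orphanˡʳ {L = L} o root    eq = map-just≢ inˡ (λ _ ()) (root? L) eq
  orphanˡʳ o (inˡ u) eq = map-just≢ inˡ (λ _ ()) (lchild u) eq
  orphanˡʳ o (inʳ u) eq = o u (map-just⁻ inʳ-injective (lchild u) eq)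

  orphanʳˡ : {v : Node L} → (∀ u → rchild u ≢ just v) →
             (u : Node (node L n R)) → rchild u ≢ just (inˡ v)
  orphanʳˡ {R = R} o root    eq = map-just≢ inʳ (λ _ ()) (root? R) eq
  orphanʳˡ o (inʳ u) eq = map-just≢ inʳ (λ _ ()) (rchild u) eq
  orphanʳˡ o (inˡ u) eq = o u (map-just⁻ inˡ-injective (rchild u) eq)

  extendˡ-maximal : (w : List⁺ (Node L)) → MaximalPath lchild w →
                    MaximalPath lchild (extendˡ {L} {n} {R} w)
  extendˡ-maximal (root  ∷ _) (o , d) = root-orphanˡ , step refl (descends-map inˡ (λ _ → refl) d)
  extendˡ-maximal (inˡ _ ∷ _) (o , d) = orphanˡˡ (λ ()) o , descends-map inˡ (λ _ → refl) d
  extendˡ-maximal (inʳ _ ∷ _) (o , d) = orphanˡˡ (λ ()) o , descends-map inˡ (λ _ → refl) d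

  extendʳ-maximal : (w : List⁺ (Node R)) → MaximalPath rchild w →
                    MaximalPath rchild (extendʳ {R} {L} {n} w)
  extendʳ-maximal (root  ∷ _) (o , d) = root-orphanʳ , step refl (descends-map inʳ (λ _ → refl) d)
  extendʳ-maximal (inˡ _ ∷ _) (o , d) = orphanʳʳ (λ ()) o , descends-map inʳ (λ _ → refl) d
  extendʳ-maximal (inʳ _ ∷ _) (o , d) = orphanʳʳ (λ ()) o , descends-map inʳ (λ _ → refl) d

  ∈-extendˡ : ∀ {v} (w : List⁺ (Node L)) → v ∈ toList w → inˡ v ∈ toList (extendˡ {L} {n} {R} w)
  ∈-extendˡ (root  ∷ _) v∈w = there (∈-map⁺ inˡ v∈w)
  ∈-extendˡ (inˡ _ ∷ _) v∈w = ∈-map⁺ inˡ v∈w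
  ∈-extendˡ (inʳ _ ∷ _) v∈w = ∈-map⁺ inˡ v∈w

  ∈-extendʳ : ∀ {v} (w : List⁺ (Node R)) → v ∈ toList w → inʳ v ∈ toList (extendʳ {R} {L} {n} w)
  ∈-extendʳ (root  ∷ _) v∈w = there (∈-map⁺ inʳ v∈w)
  ∈-extendʳ (inˡ _ ∷ _) v∈w = ∈-map⁺ inʳ v∈w
  ∈-extendʳ (inʳ _ ∷ _) v∈w = ∈-map⁺ inʳ v∈w

lpath-maximal : (v : Node T) → MaximalPath lchild (lpath v)
lpath-maximal root    = root-orphanˡ , lspine-descends _ _ _
lpath-maximal (inˡ v) = extendˡ-maximal (lpath v) (lpath-maximal v)
lpath-maximal (inʳ v) with lpath v | lpath-maximal v
... | _ ∷ _ | o , d = orphanˡʳ o , descends-map inʳ (λ _ → refl) d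

rpath-maximal : (v : Node T) → MaximalPath rchild (rpath v)
rpath-maximal root    = root-orphanʳ , rspine-descends _ _ _
rpath-maximal (inʳ v) = extendʳ-maximal (rpath v) (rpath-maximal v)
rpath-maximal (inˡ v) with rpath v | rpath-maximal v
... | _ ∷ _ | o , d = orphanʳˡ o , descends-map inˡ (λ _ → refl) d

∈-lpath : (v : Node T) → v ∈ toList (lpath v)
∈-lpath root    = here refl
∈-lpath (inˡ v) = ∈-extendˡ (lpath v) (∈-lpath v)
∈-lpath (inʳ v) = ∈-map⁺ inʳ (∈-lpath v)

∈-rpath : (v : Node T) → v ∈ toList (rpath v)
∈-rpath root    = here refl
∈-rpath (inˡ v) = ∈-map⁺ inˡ (∈-rpath v)
∈-rpath (inʳ v) = ∈-extendʳ (rpath v) (∈-rpath v)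

lchild-injective : ∀ {w} (u v : Node T) → lchild u ≡ just w → lchild v ≡ just w → u ≡ v
lchild-injective {node (node _ _ _) _ _} root root _ _ = refl
lchild-injective {node (node _ _ _) _ _} root (inˡ v) refl q =
  contradiction (map-just⁻ inˡ-injective (lchild v) q) (root-orphanˡ v)
lchild-injective {node (node _ _ _) _ _} root (inʳ v) refl q = contradiction q (map-just≢ inʳ (λ _ ()) (lchild v))
lchild-injective {node (node _ _ _) _ _} (inˡ u) root p refl =
  contradiction (map-just⁻ inˡ-injective (lchild u) p) (root-orphanˡ u)
lchild-injective {node (node _ _ _) _ _} (inʳ u) root p refl = contradiction p (map-just≢ inʳ (λ _ ()) (lchild u))
lchild-injective (inˡ u) (inˡ v) p q with map-just⁺ inˡ (lchild u) p
... | _ , p′ , refl = cong inˡ (lchild-injective u v p′ (map-just⁻ inˡ-injective (lchild v) q))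
lchild-injective (inˡ u) (inʳ v) p q with map-just⁺ inˡ (lchild u) p
... | _ , _ , refl = contradiction q (map-just≢ inʳ (λ _ ()) (lchild v))
lchild-injective (inʳ u) (inˡ v) p q with map-just⁺ inʳ (lchild u) p
... | _ , _ , refl = contradiction q (map-just≢ inˡ (λ _ ()) (lchild v))
lchild-injective (inʳ u) (inʳ v) p q with map-just⁺ inʳ (lchild u) p
... | _ , p′ , refl = cong inʳ (lchild-injective u v p′ (map-just⁻ inʳ-injective (lchild v) q))

rchild-injective : ∀ {w} (u v : Node T) → rchild u ≡ just w → rchild v ≡ just w → u ≡ v
rchild-injective {node _ _ (node _ _ _)} root root _ _ = refl
rchild-injective {node _ _ (node _ _ _)} root (inʳ v) refl q =
  contradiction (map-just⁻ inʳ-injective (rchild v) q) (root-orphanʳ v)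
rchild-injective {node _ _ (node _ _ _)} root (inˡ v) refl q = contradiction q (map-just≢ inˡ (λ _ ()) (rchild v))
rchild-injective {node _ _ (node _ _ _)} (inʳ u) root p refl =
  contradiction (map-just⁻ inʳ-injective (rchild u) p) (root-orphanʳ u)
rchild-injective {node _ _ (node _ _ _)} (inˡ u) root p refl = contradiction p (map-just≢ inˡ (λ _ ()) (rchild u))
rchild-injective (inˡ u) (inˡ v) p q with map-just⁺ inˡ (rchild u) p
... | _ , p′ , refl = cong inˡ (rchild-injective u v p′ (map-just⁻ inˡ-injective (rchild v) q))
rchild-injective (inˡ u) (inʳ v) p q with map-just⁺ inˡ (rchild u) p
... | _ , _ , refl = contradiction q (map-just≢ inʳ (λ _ ()) (rchild v))
rchild-injective (inʳ u) (inˡ v) p q with map-just⁺ inʳ (rchild u) p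
... | _ , _ , refl = contradiction q (map-just≢ inˡ (λ _ ()) (rchild v))
rchild-injective (inʳ u) (inʳ v) p q with map-just⁺ inʳ (rchild u) p
... | _ , p′ , refl = cong inʳ (rchild-injective u v p′ (map-just⁻ inʳ-injective (rchild v) q))

private
  module _ (child : Node T → Maybe (Node T))
           (child-injective : ∀ {w} (u v : Node T) → child u ≡ just w → child v ≡ just w → u ≡ v)
           where

    data Below (u : Node T) : Node T → Set where
      self : Below u u
      next : ∀ {v w} → Below u v → child v ≡ just w → Below u w

    shift : ∀ {u v w} → child u ≡ just v → Below v w → Below u w
    shift eq self        = next self eq
    shift eq (next b e)  = next (shift eq b) e

    descends-below : ∀ {u v us} → DescendsFrom child u us → v ∈ u ∷ us → Below u v
    descends-below d           (here refl) = self
    descends-below (step eq d) (there v∈)  = shift eq (descends-below d v∈)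

    top-unique : ∀ {u u′ v} → (∀ x → child x ≢ just u) → (∀ x → child x ≢ just u′) →
                 Below u v → Below u′ v → u ≡ u′
    top-unique o o′ self       self         = refl
    top-unique o o′ self       (next _ e)   = ⊥-elim (o _ e)
    top-unique o o′ (next _ e) self         = ⊥-elim (o′ _ e)
    top-unique o o′ (next b e) (next b′ e′) with child-injective _ _ e e′
    ... | refl = top-unique o o′ b b′

    descends-unique : ∀ {v us us′} → DescendsFrom child v us → DescendsFrom child v us′ → us ≡ us′
    descends-unique (stop _)   (stop _)     = refl
    descends-unique (stop e)   (step e′ _)  = contradiction (trans (sym e) e′) λ ()
    descends-unique (step e _) (stop e′)    = contradiction (trans (sym e) e′) λ ()
    descends-unique (step e d) (step e′ d′) with just-injective (trans (sym e) e′)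
    ... | refl = cong (_ ∷_) (descends-unique d d′)

    maximal-unique : ∀ {v} (w w′ : List⁺ (Node T)) → MaximalPath child w → MaximalPath child w′ →
                     v ∈ toList w → v ∈ toList w′ → w ≡ w′
    maximal-unique (_ ∷ _) (_ ∷ _) (o , d) (o′ , d′) v∈w v∈w′
      with top-unique o o′ (descends-below d v∈w) (descends-below d′ v∈w′)
    ... | refl = cong (_ ∷_) (descends-unique d d′)

lpath-unique : (v : Node T) (w : List⁺ (Node T)) → MaximalPath lchild w → v ∈ toList w → w ≡ lpath v
lpath-unique v w m v∈w =
  maximal-unique lchild lchild-injective w (lpath v) m (lpath-maximal v) v∈w (∈-lpath v)

rpath-unique : (v : Node T) (w : List⁺ (Node T)) → MaximalPath rchild w → v ∈ toList w → w ≡ rpath v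
rpath-unique v w m v∈w =
  maximal-unique rchild rchild-injective w (rpath v) m (rpath-maximal v) v∈w (∈-rpath v)

------------------------------------------------------------------------
-- The Fishburn cover of a Fishburn tree

diag : ∀ T → List (Node T)
diag (leaf _)     = []
diag (node _ _ _) = toList (lpath root)

-- The value [] in the absence of a left child is never used for v in
-- asctops, since the first node in in-order lies on the diagonal.
W : Node T → List (Node T)
W {T} v = if does (v ∈? diag T)
          then toList (rpath v)
          else maybe′ (toList ∘ rpath) [] (lchild v)
  where open DecMembership _≟_ using (_∈?_)

private
  ∈-inorder : (v : Node T) → v ∈ inorder T
  ∈-inorder {node L _ _} root    = ∈-++⁺ʳ (map inˡ (inorder L)) (here refl)
  ∈-inorder (inˡ v)              = ∈-++⁺ˡ (∈-map⁺ inˡ (∈-inorder v))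
  ∈-inorder {node L _ _} (inʳ v) =
    ∈-++⁺ʳ (map inˡ (inorder L)) (there (∈-map⁺ inʳ (∈-inorder v)))

  first : ∀ {A : Set} (f : A → ℕ) {i} (xs : List A) → Any (λ x → f x ≡ i) xs →
          ∃ λ j → f (lookup xs j) ≡ i × (∀ j′ → j′ <ᶠ j → f (lookup xs j′) ≢ i)
  first f {i} (x ∷ xs) p with f x ℕ.≟ i
  first f (x ∷ xs) p         | yes eq = zero , eq , λ _ ()
  first f (x ∷ xs) (here eq) | no  ne = contradiction eq ne
  first f (x ∷ xs) (there p) | no  ne with first f xs p
  ... | j , eq , before = suc j , eq , λ { zero _ → ne ; (suc j′) (s≤s lt) → before j′ lt }

  max-attained : ∀ T → max T ≡ 0 ⊎ ∃ λ (v : Node T) → label v ≡ max T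
  max-attained (leaf _) = inj₁ refl
  max-attained (node L n R) with ⊔-sel n (max L ⊔ max R)
  ... | inj₁ eq = inj₂ (root , sym eq)
  ... | inj₂ eq with ⊔-sel (max L) (max R)
  ...   | inj₁ eqL with max-attained L
  ...     | inj₁ z       = inj₁ (trans eq (trans eqL z))
  ...     | inj₂ (v , p) = inj₂ (inˡ v , trans p (sym (trans eq eqL)))
  max-attained (node L n R) | inj₂ eq | inj₂ eqR with max-attained R
  ...     | inj₁ z       = inj₁ (trans eq (trans eqR z))
  ...     | inj₂ (v , p) = inj₂ (inʳ v , trans p (sym (trans eq eqR)))

  label-occurs : Regular T → ∀ {i} → i ∈[ max T ] → ∃ λ (v : Node T) → label v ≡ i
  label-occurs {T} (k , _ , spec) {i} (1≤i , i≤max) with max-attained T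
  ... | inj₁ z = contradiction (≤-trans 1≤i (≤-trans i≤max (≤-reflexive z))) λ ()
  ... | inj₂ v = Equivalence.from (spec i)
                   (1≤i , ≤-trans i≤max (proj₂ (Equivalence.to (spec (max T)) v)))

  nub-unique : (u v : Node T) → Nub u → Nub v → label u ≡ label v → u ≡ v
  nub-unique u v (i , refl , beforeᵢ) (j , refl , beforeⱼ) eq with Fin.<-cmp i j
  ... | tri< i<j _ _  = contradiction eq (beforeⱼ i i<j)
  ... | tri≈ _ refl _ = refl
  ... | tri> _ _ j<i  = contradiction (sym eq) (beforeᵢ j j<i)

asctops-transversal : IsFishburnTree T → ∀ {i} → i ∈[ max T ] →
                      ∃! _≡_ λ (v : Node T) → AscTop v × label v ≡ i
asctops-transversal {T} F {i} i∈[k] with label-occurs regular i∈[k]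
  where open IsFishburnTree F
... | u , refl with first label (inorder T) (lose (∈-inorder u) refl)
...   | j , eq , before =
  v , (proj₁ nub≐asctops (j , refl , λ i i<j e → before i i<j (trans e eq)) , eq) ,
  λ {w} (w∈asctops , e) →
    nub-unique v w (j , refl , λ i i<j e → before i i<j (trans e eq))
      (proj₂ nub≐asctops w∈asctops) (trans eq (sym e))
  where
  open IsFishburnTree F
  v = lookup (inorder T) j

asctop : IsFishburnTree T → ∀ {i} → i ∈[ max T ] → Node T
asctop F i∈[k] = proj₁ (asctops-transversal F i∈[k])

-- Multisets are lists up to permutation.
Multiset : Set
Multiset = List ℕ

infix 4 _≋_

_≋_ : List Multiset → List Multiset → Set
_≋_ = Pointwise _↭_

-- The index i : Fin (max T) stands for the label suc (toℕ i).
𝔓 : (T : LTree) → IsFishburnTree T → List Multiset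
𝔓 T F = tabulate λ (i : Fin (max T)) →
  map label (W (asctop F {suc (toℕ i)} (s≤s z≤n , Fin.toℕ<n i)))

------------------------------------------------------------------------
-- Fishburn covers

-- The block at index i : Fin (length P) is B_{i+1}.
record IsFishburnCover (P : List Multiset) : Set where
  field
    nonempty : All (_≢ []) P
    support  : ∀ j → (∃ λ i → j ∈ lookup P i) ⇔ j ∈[ length P ]
    bounded  : ∀ i {j} → j ∈ lookup P i → j ≤ suc (toℕ i)

{-# OPTIONS --safe #-}

-- Traverse a Fishburn tree in in-order and record the labels seen so far.
-- The condition nub = asctops says that a node off the diagonal has a left
-- child exactly if its label is new, and 𝔓(T) = P says that the right
-- path hanging to its left then carries the labels of the block of that
-- label.  So a right path off the diagonal and the labels seen before it
-- determine the subtree.  The labels d on the diagonal are those with d ∈ B_d,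
-- and the right path starting at such a node carries B_d.  Uniqueness follows
-- by induction on trees; reading the same description as a construction gives
-- existence: the diagonal is built bottom up, and every block is used because
-- each i in [k] lies in some B_n with n ≥ i.
module Submission where

open import Defs
open import Data.Fin.Base using (Fin; zero; suc; toℕ; fromℕ<) renaming (_<_ to _<ᶠ_)
import Data.Fin.Properties as Fin
open import Data.List.Base using (List; []; _∷_; _++_; map; head; length; lookup; tabulate)
import Data.List.Membership.DecPropositional as DecMembership
open import Data.List.Membership.Propositional using (_∈_; _∉_)
open import Data.List.Membership.Propositional.Properties using (∈-++⁺ˡ; ∈-++⁺ʳ; ∈-map⁺; ∈-map⁻; ∈-lookup)
open import Data.List.NonEmpty.Base using (toList; _∷_) renaming (map to map⁺)
open import Data.List.Properties using (map-∘; length-++; length-map)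
open import Data.List.Relation.Binary.Permutation.Propositional using (_↭_; ↭-sym; ↭-trans; ↭-reflexive)
open import Data.List.Relation.Binary.Permutation.Propositional.Properties using (∈-resp-↭; drop-∷; ¬x∷xs↭[]; ↭-empty-inv)
open import Data.List.Relation.Binary.Pointwise.Base using ([]; _∷_)
open import Data.List.Relation.Unary.All as All using (All; []; _∷_)
import Data.List.Relation.Unary.All.Properties as All
open import Data.List.Relation.Unary.AllPairs as AllPairs using (AllPairs; []; _∷_)
import Data.List.Relation.Unary.AllPairs.Properties as AllPairs
open import Data.List.Relation.Unary.Any using (here; there; index)
open import Data.List.Relation.Unary.Any.Properties using (lookup-index)
open import Data.List.Relation.Unary.Linked.Properties using (Linked⇒AllPairs)
open import Data.Maybe.Base using (just; nothing; maybe′)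
open import Data.Nat.Base using (ℕ; zero; suc; _+_; _≤_; _<_; _≥_; _⊔_; z≤n; s≤s; s≤s⁻¹; z<s; s<s)
open import Data.Nat.Properties as ℕ hiding (_≟_)
open import Data.Product using (Σ; ∃!; _×_; _,_; ∃; proj₁; proj₂)
open import Data.Sum.Base using (_⊎_; inj₁; inj₂)
open import Data.Tree.Binary using (leaf; node; #nodes)
open import Data.Unit.Base using (⊤; tt)
open import Function.Base using (_∘_)
open import Function.Bundles using (_⇔_; Equivalence; mk⇔)
open import Relation.Binary.Construct.Flip.EqAndOrd using (decTotalOrder)
open import Relation.Binary.Definitions using (tri<; tri≈; tri>)
open import Relation.Binary.PropositionalEquality using (_≡_; _≢_; refl; sym; trans; cong; cong₂; subst)
open import Relation.Nullary.Decidable using (yes; no)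
open import Relation.Nullary.Negation using (¬_; contradiction)

open import Data.List.Sort (decTotalOrder ≤-decTotalOrder) using (sort; sort-↭; sort-↗)
open DecMembership ℕ._≟_ using (_∈?_)
open Equivalence using (to; from)

private
  variable
    S : List ℕ
    T T′ L R : LTree
    k n x y : ℕ

-- Left subtrees and ascent tops, by recursion on nodes

leftOf : Node T → LTree
leftOf {node L _ _} root = L
leftOf (inˡ v) = leftOf v
leftOf (inʳ v) = leftOf v

lchild⇒leftOf≢∅ : ∀ {u} (v : Node T) → lchild v ≡ just u → leftOf v ≢ ∅
lchild⇒leftOf≢∅ {node (node _ _ _) _ _} root _ ()
lchild⇒leftOf≢∅ (inˡ v) eq with lchild v in e
... | just _ = lchild⇒leftOf≢∅ v e
lchild⇒leftOf≢∅ (inʳ v) eq with lchild v in e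
... | just _ = lchild⇒leftOf≢∅ v e

leftOf≢∅⇒lchild : (v : Node T) → leftOf v ≢ ∅ → ∃ λ u → lchild v ≡ just u
leftOf≢∅⇒lchild {node (leaf _) _ _}     root ≢∅ = contradiction refl ≢∅
leftOf≢∅⇒lchild {node (node _ _ _) _ _} root ≢∅ = _ , refl
leftOf≢∅⇒lchild (inˡ v) ≢∅ with leftOf≢∅⇒lchild v ≢∅
... | u , eq rewrite eq = _ , refl
leftOf≢∅⇒lchild (inʳ v) ≢∅ with leftOf≢∅⇒lchild v ≢∅
... | u , eq rewrite eq = _ , refl

lchild-nothing : (v : Node T) → lchild v ≡ nothing → leftOf v ≡ ∅
lchild-nothing {node (leaf _) _ _} root _ = refl
lchild-nothing (inˡ v) eq with lchild v in e
... | nothing = lchild-nothing v e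
lchild-nothing (inʳ v) eq with lchild v in e
... | nothing = lchild-nothing v e

lchild≢root : (v : Node (node L n R)) → lchild v ≢ just root
lchild≢root {L = leaf _}     root ()
lchild≢root {L = node _ _ _} root ()
lchild≢root (inˡ v) eq with lchild v
lchild≢root (inˡ v) () | just _
lchild≢root (inʳ v) eq with lchild v
lchild≢root (inʳ v) () | just _

-- The root is an ascent top whether or not it has a left child: without
-- one it is the first node in in-order.
Asc : Node T → Set
Asc root    = ⊤
Asc (inˡ v) = Asc v
Asc (inʳ v) = leftOf v ≢ ∅

head-inˡ⁻ : ∀ {v : Node L} xs {ys} → head (map (inˡ {L} {n} {R}) xs ++ root ∷ ys) ≡ just (inˡ v) →
            head xs ≡ just v
head-inˡ⁻ (_ ∷ _) refl = refl

head-inˡ⁺ : ∀ {v : Node L} xs {ys} → head xs ≡ just v →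
            head (map (inˡ {L} {n} {R}) xs ++ root ∷ ys) ≡ just (inˡ v)
head-inˡ⁺ (_ ∷ _) refl = refl

head≢inʳ : ∀ {v : Node R} xs {ys} → head (map (inˡ {L} {n} {R}) xs ++ root ∷ ys) ≢ just (inʳ v)
head≢inʳ [] ()
head≢inʳ (_ ∷ _) ()

AscTop⇒Asc : (v : Node T) → AscTop v → Asc v
AscTop⇒Asc root    _         = tt
AscTop⇒Asc {node L _ _} (inˡ v) (inj₁ eq) = AscTop⇒Asc v (inj₁ (head-inˡ⁻ (inorder L) eq))
AscTop⇒Asc (inˡ v) (inj₂ (u , eq)) with lchild v in e
... | just w = AscTop⇒Asc v (inj₂ (w , e))
AscTop⇒Asc {node L _ _} (inʳ v) (inj₁ eq) = contradiction eq (head≢inʳ (inorder L))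
AscTop⇒Asc (inʳ v) (inj₂ (u , eq)) = lchild⇒leftOf≢∅ (inʳ v) eq

Asc⇒AscTop : (v : Node T) → Asc v → AscTop v
Asc⇒AscTop {node (leaf _) _ _}     root _ = inj₁ refl
Asc⇒AscTop {node (node _ _ _) _ _} root _ = inj₂ (_ , refl)
Asc⇒AscTop {node L _ _} (inˡ v) a with Asc⇒AscTop v a
... | inj₁ eq       = inj₁ (head-inˡ⁺ (inorder L) eq)
... | inj₂ (u , eq) = inj₂ (leftOf≢∅⇒lchild (inˡ v) (lchild⇒leftOf≢∅ v eq))
Asc⇒AscTop (inʳ v) a = inj₂ (leftOf≢∅⇒lchild (inʳ v) a)

-- Labels along right paths and the blocks of a tree

rlabels : LTree → List ℕ
rlabels (leaf _)     = []
rlabels (node _ n R) = n ∷ rlabels R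

map-label-rspine : ∀ T → map label (rspine T) ≡ rlabels T
map-label-rspine (leaf _)     = refl
map-label-rspine (node _ n R) = cong (n ∷_) (trans (sym (map-∘ (rspine R))) (map-label-rspine R))

-- A left child is not a right child, so its right path starts with it; `lchild≢root` rules out the
-- case in which `extendʳ` would prepend the root.
rpath-lchild : ∀ {u} (v : Node T) → lchild v ≡ just u →
               ∃ λ us → rpath u ≡ u ∷ us × label u ∷ map label us ≡ rlabels (leftOf v)
rpath-lchild {node (node K m M) _ _} root refl =
  map inˡ (map inʳ (rspine M)) , refl ,
  cong (m ∷_) (trans (sym (map-∘ (map inʳ (rspine M))))
    (trans (sym (map-∘ (rspine M))) (map-label-rspine M)))
rpath-lchild (inˡ v) eq with lchild v in e
rpath-lchild (inˡ v) refl | just u with rpath-lchild v e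
... | us , p , q = map inˡ us , cong (map⁺ inˡ) p , trans (cong (_ ∷_) (sym (map-∘ us))) q
rpath-lchild (inʳ v) eq with lchild v in e
rpath-lchild (inʳ v) refl | just u with rpath-lchild v e
rpath-lchild (inʳ v) refl | just root    | _ = contradiction e (lchild≢root v)
rpath-lchild (inʳ v) refl | just (inˡ _) | us , p , q =
  map inʳ us , cong extendʳ p , trans (cong (_ ∷_) (sym (map-∘ us))) q
rpath-lchild (inʳ v) refl | just (inʳ _) | us , p , q =
  map inʳ us , cong extendʳ p , trans (cong (_ ∷_) (sym (map-∘ us))) q

-- A recursive form of `map label (W v)`: a node reached by left steps only lies on the diagonal,
-- and the first right step leaves the diagonal for good.
block : Node T → Multiset
block {node _ n R} root = n ∷ rlabels R
block (inˡ v) = block v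
block (inʳ v) = rlabels (leftOf v)

diag≡lspine : ∀ T → diag T ≡ lspine T
diag≡lspine (leaf _)     = refl
diag≡lspine (node _ _ _) = refl

rpath-diag : (v : Node T) → v ∈ lspine T → map label (toList (rpath v)) ≡ block v
rpath-diag {node _ n R} root _ =
  cong (n ∷_) (trans (sym (map-∘ (rspine R))) (map-label-rspine R))
rpath-diag {node L _ _} (inˡ v) (there v∈) with ∈-map⁻ inˡ v∈
... | _ , v∈′ , refl = trans (sym (map-∘ (toList (rpath v)))) (rpath-diag v v∈′)
rpath-diag {node L _ _} (inʳ v) (there v∈) with ∈-map⁻ inˡ v∈
... | _ , _ , ()

block-offdiag : (v : Node T) → v ∉ lspine T → block v ≡ rlabels (leftOf v)
block-offdiag root    v∉ = contradiction (here refl) v∉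
block-offdiag (inˡ v) v∉ = block-offdiag v (v∉ ∘ there ∘ ∈-map⁺ inˡ)
block-offdiag (inʳ v) _  = refl

rpath-lchild-labels : (v : Node T) →
  map label (maybe′ (toList ∘ rpath) [] (lchild v)) ≡ rlabels (leftOf v)
rpath-lchild-labels v with lchild v in e
-- The default `[]` in `W` agrees with `rlabels ∅`.
... | nothing = cong rlabels (sym (lchild-nothing v e))
... | just u with rpath-lchild v e
...   | us , p , q rewrite p = q

map-label-W : (v : Node T) → map label (W v) ≡ block v
map-label-W {T} v with v ∈ᵀ? diag T
  where open DecMembership (Defs._≟_ {T}) renaming (_∈?_ to _∈ᵀ?_)
... | yes v∈ = rpath-diag v (subst (v ∈_) (diag≡lspine T) v∈)
... | no  v∉ = trans (rpath-lchild-labels v)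
                     (sym (block-offdiag v (v∉ ∘ subst (v ∈_) (sym (diag≡lspine T)))))

-- In-order precedence and the nub

infix 4 _≺_

-- u ≺ v: the in-order traversal visits u before v.
data _≺_ : Node T → Node T → Set where
  inˡ≺root : ∀ {u : Node L} → inˡ {L} {n} {R} u ≺ root
  root≺inʳ : ∀ {v : Node R} → root ≺ inʳ {L} {n} {R} v
  inˡ≺inʳ  : ∀ {u : Node L} {v : Node R} → inˡ {L} {n} {R} u ≺ inʳ v
  inˡ      : ∀ {u v : Node L} → u ≺ v → inˡ {L} {n} {R} u ≺ inˡ v
  inʳ      : ∀ {u v : Node R} → u ≺ v → inʳ {L} {n} {R} u ≺ inʳ v

≺-asym : {u v : Node T} → u ≺ v → ¬ v ≺ u
≺-asym (inˡ p) (inˡ q) = ≺-asym p q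
≺-asym (inʳ p) (inʳ q) = ≺-asym p q

∈-inorder : (v : Node T) → v ∈ inorder T
∈-inorder {node L _ _} root    = ∈-++⁺ʳ (map inˡ (inorder L)) (here refl)
∈-inorder              (inˡ v) = ∈-++⁺ˡ (∈-map⁺ inˡ (∈-inorder v))
∈-inorder {node L _ _} (inʳ v) = ∈-++⁺ʳ (map inˡ (inorder L)) (there (∈-map⁺ inʳ (∈-inorder v)))

inorder-≺ : ∀ T → AllPairs _≺_ (inorder T)
inorder-≺ (leaf _)     = []
inorder-≺ (node L _ R) =
  AllPairs.++⁺ (AllPairs.map⁺ (AllPairs.map inˡ (inorder-≺ L)))
    (All.map⁺ (All.universal (λ _ → root≺inʳ) (inorder R)) ∷
     AllPairs.map⁺ (AllPairs.map inʳ (inorder-≺ R)))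
    (All.map⁺ (All.universal
      (λ _ → inˡ≺root ∷ All.map⁺ (All.universal (λ _ → inˡ≺inʳ) (inorder R))) (inorder L)))

AllPairs-lookup : ∀ {A : Set} {_~_ : A → A → Set} {xs} → AllPairs _~_ xs →
                  ∀ {i j} → i <ᶠ j → lookup xs i ~ lookup xs j
AllPairs-lookup (x~ ∷ _)  {zero}  {suc j} _         = All.lookup x~ (∈-lookup j)
AllPairs-lookup (_ ∷ xs~) {suc i} {suc j} (s<s i<j) = AllPairs-lookup xs~ i<j

-- Later positions in `inorder` hold later nodes, so by asymmetry `u ≺ v` forces the position of `u`
-- below that of `v`.
Nub⇒first : {u v : Node T} → Nub v → u ≺ v → label u ≢ label v
Nub⇒first {T} {u} (j , refl , fresh) u≺v eq with Fin.<-cmp (index (∈-inorder u)) j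
... | tri< i<j _ _  = fresh _ i<j (trans (cong label (sym (lookup-index (∈-inorder u)))) eq)
... | tri> _ _ j<i  = ≺-asym u≺v
  (subst (lookup (inorder T) j ≺_) (sym (lookup-index (∈-inorder u)))
    (AllPairs-lookup (inorder-≺ T) j<i))
... | tri≈ _ refl _ = ≺-asym u≺u u≺u
  where
  u≺u : u ≺ u
  u≺u = subst (u ≺_) (sym (lookup-index (∈-inorder u))) u≺v

first⇒Nub : (v : Node T) → (∀ {u} → u ≺ v → label u ≢ label v) → Nub v
first⇒Nub {T} v fresh = index (∈-inorder v) , sym v≡ , λ i i<j →
  fresh (subst (lookup (inorder T) i ≺_) (sym v≡) (AllPairs-lookup (inorder-≺ T) i<j))
  where
  v≡ : v ≡ lookup (inorder T) (index (∈-inorder v))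
  v≡ = lookup-index (∈-inorder v)

-- Labels visited by the in-order traversal

Occurs : ℕ → LTree → Set
Occurs x T = ∃ λ (v : Node T) → label v ≡ x

-- visit S T extends S by the labels of T, and seen S v by the labels of the
-- nodes visited before v.
visit : List ℕ → LTree → List ℕ
visit S (leaf _)     = S
visit S (node L n R) = visit (n ∷ visit S L) R

seen : List ℕ → Node T → List ℕ
seen {node L _ _} S root    = visit S L
seen              S (inˡ v) = seen S v
seen {node L n _} S (inʳ v) = seen (n ∷ visit S L) v

visit⁺ˡ : ∀ T → x ∈ S → x ∈ visit S T
visit⁺ˡ (leaf _)     x∈S = x∈S
visit⁺ˡ (node L _ R) x∈S = visit⁺ˡ R (there (visit⁺ˡ L x∈S))

visit⁺ʳ : (v : Node T) → label v ∈ visit S T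
visit⁺ʳ {node L n R} root    = visit⁺ˡ R (here refl)
visit⁺ʳ {node L n R} (inˡ v) = visit⁺ˡ R (there (visit⁺ʳ v))
visit⁺ʳ {node L n R} (inʳ v) = visit⁺ʳ v

visit⁻ : ∀ T → x ∈ visit S T → x ∈ S ⊎ Occurs x T
visit⁻ (leaf _)     x∈ = inj₁ x∈
visit⁻ (node L n R) x∈ with visit⁻ R x∈
... | inj₂ (v , eq)    = inj₂ (inʳ v , eq)
... | inj₁ (here refl) = inj₂ (root , refl)
... | inj₁ (there x∈′) with visit⁻ L x∈′
...   | inj₁ x∈S       = inj₁ x∈S
...   | inj₂ (v , eq)  = inj₂ (inˡ v , eq)

seen⁺ˡ : (v : Node T) → x ∈ S → x ∈ seen S v
seen⁺ˡ {node L _ _} root    x∈S = visit⁺ˡ L x∈S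
seen⁺ˡ              (inˡ v) x∈S = seen⁺ˡ v x∈S
seen⁺ˡ {node L _ _} (inʳ v) x∈S = seen⁺ˡ v (there (visit⁺ˡ L x∈S))

seen⁺ʳ : {u v : Node T} → u ≺ v → label u ∈ seen S v
seen⁺ʳ {u = inˡ u}              inˡ≺root = visit⁺ʳ u
seen⁺ʳ {v = inʳ v}              root≺inʳ = seen⁺ˡ v (here refl)
seen⁺ʳ {u = inˡ u} {v = inʳ v}  inˡ≺inʳ  = seen⁺ˡ v (there (visit⁺ʳ u))
seen⁺ʳ                          (inˡ p)  = seen⁺ʳ p
seen⁺ʳ                          (inʳ p)  = seen⁺ʳ p

seen⁻ : (v : Node T) → x ∈ seen S v → x ∈ S ⊎ ∃ λ u → u ≺ v × label u ≡ x
seen⁻ {node L _ _} root x∈ with visit⁻ L x∈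
... | inj₁ x∈S      = inj₁ x∈S
... | inj₂ (u , eq) = inj₂ (inˡ u , inˡ≺root , eq)
seen⁻ (inˡ v) x∈ with seen⁻ v x∈
... | inj₁ x∈S            = inj₁ x∈S
... | inj₂ (u , u≺v , eq) = inj₂ (inˡ u , inˡ u≺v , eq)
seen⁻ {node L _ _} (inʳ v) x∈ with seen⁻ v x∈
... | inj₂ (u , u≺v , eq) = inj₂ (inʳ u , inʳ u≺v , eq)
... | inj₁ (here refl)    = inj₂ (root , root≺inʳ , refl)
... | inj₁ (there x∈′) with visit⁻ L x∈′
...   | inj₁ x∈S          = inj₁ x∈S
...   | inj₂ (u , eq)     = inj₂ (inˡ u , inˡ≺inʳ , eq)

Nub⇒∉seen : (v : Node T) → Nub v → label v ∉ seen [] v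
Nub⇒∉seen v nub v∈ with seen⁻ v v∈
... | inj₂ (u , u≺v , eq) = Nub⇒first nub u≺v eq

∉seen⇒Nub : (v : Node T) → label v ∉ seen [] v → Nub v
∉seen⇒Nub v v∉ = first⇒Nub v λ u≺v eq → v∉ (subst (_∈ seen [] v) eq (seen⁺ʳ u≺v))

-- Label bounds, node counts and first occurrences

label≤max : (v : Node T) → label v ≤ max T
label≤max {node L n R} root    = m≤m⊔n n _
label≤max {node L n R} (inˡ v) = ≤-trans (label≤max v) (m≤n⇒m≤o⊔n n (m≤m⊔n _ _))
label≤max {node L n R} (inʳ v) = ≤-trans (label≤max v) (m≤n⇒m≤o⊔n n (m≤n⊔m (max L) _))

occurs≤max : Occurs x T → x ≤ max T
occurs≤max (v , refl) = label≤max v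

rlabels-occur : ∀ T → x ∈ rlabels T → Occurs x T
rlabels-occur (node _ _ _) (here refl) = root , refl
rlabels-occur (node _ _ R) (there x∈) with rlabels-occur R x∈
... | v , eq = inʳ v , eq

max-node : ∀ L R → max L < n → max R ≤ n → n ⊔ (max L ⊔ max R) ≡ n
max-node _ _ L<n R≤n = m≥n⇒m⊔n≡m (⊔-lub (<⇒≤ L<n) R≤n)

rlabels-head≤ : max R ≤ n → x ∈ n ∷ rlabels R → x ≤ n
rlabels-head≤         R≤n (here refl) = ≤-refl
rlabels-head≤ {R = R} R≤n (there x∈)  = ≤-trans (occurs≤max (rlabels-occur R x∈)) R≤n

leftOf-occurs : (v : Node T) → Occurs x (leftOf v) → Occurs x T
leftOf-occurs root    (u , eq) = inˡ u , eq
leftOf-occurs (inˡ v) occ with leftOf-occurs v occ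
... | u , eq = inˡ u , eq
leftOf-occurs (inʳ v) occ with leftOf-occurs v occ
... | u , eq = inʳ u , eq

block-occurs : (v : Node T) → x ∈ block v → Occurs x T
block-occurs {T} root x∈ = rlabels-occur T x∈
block-occurs (inˡ v) x∈ with block-occurs v x∈
... | u , eq = inˡ u , eq
block-occurs (inʳ v) x∈ = leftOf-occurs (inʳ v) (rlabels-occur (leftOf v) x∈)

max-leftOf< : StrictlyDecreasingLeft T → (v : Node T) → max (leftOf v) < label v
max-leftOf< (L<n , _ , _) root    = L<n
max-leftOf< (_ , sL , _)  (inˡ v) = max-leftOf< sL v
max-leftOf< (_ , _ , sR)  (inʳ v) = max-leftOf< sR v

length-inorder : ∀ T → length (inorder T) ≡ #nodes T
length-inorder (leaf _)     = refl
length-inorder (node L _ R) =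
  trans (length-++ (map inˡ (inorder L)))
    (cong₂ (λ l r → l + suc r) (trans (length-map inˡ (inorder L)) (length-inorder L))
                               (trans (length-map inʳ (inorder R)) (length-inorder R)))

∈[]⇒toℕ : x ∈[ k ] → ∃ λ (i : Fin k) → suc (toℕ i) ≡ x
∈[]⇒toℕ {suc x} (_ , x<k) = fromℕ< x<k , cong suc (Fin.toℕ-fromℕ< x<k)

-- Pigeonhole: sending each label to the in-order position of a node that carries it is injective.
all-occur⇒≤#nodes : (∀ {i} → i ∈[ k ] → Occurs i T) → k ≤ #nodes T
all-occur⇒≤#nodes {k} {T} occ = subst (k ≤_) (length-inorder T) (Fin.injective⇒≤ position-injective)
  where
  at : ∀ (i : Fin k) → Occurs (suc (toℕ i)) T
  at i = occ (z<s , Fin.toℕ<n i)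

  position : Fin k → Fin (length (inorder T))
  position i = index (∈-inorder (proj₁ (at i)))

  label-position : ∀ i → label (lookup (inorder T) (position i)) ≡ suc (toℕ i)
  label-position i =
    trans (cong label (sym (lookup-index (∈-inorder (proj₁ (at i)))))) (proj₂ (at i))

  position-injective : ∀ {i j} → position i ≡ position j → i ≡ j
  position-injective {i} {j} eq = Fin.toℕ-injective (suc-injective
    (trans (sym (label-position i))
      (trans (cong (label ∘ lookup (inorder T)) eq) (label-position j))))

-- The search in the right subtree starts from `n ∷ visit S L`. If it finds `x` already there, the
-- search moves back to the root and then to the left subtree.
first-occurrence : ∀ S T → Occurs x T → x ∈ S ⊎ ∃ λ (w : Node T) → label w ≡ x × label w ∉ seen S w
first-occurrence {x} S (node L n R) = λ where
    (root  , refl) → atRoot (here refl)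
    (inˡ v , eq)   → liftˡ (first-occurrence S L (v , eq))
    (inʳ v , eq)   → liftʳ (first-occurrence (n ∷ visit S L) R (v , eq))
  where
  Goal = x ∈ S ⊎ ∃ λ (w : Node (node L n R)) → label w ≡ x × label w ∉ seen S w

  liftˡ : (x ∈ S ⊎ ∃ λ (w : Node L) → label w ≡ x × label w ∉ seen S w) → Goal
  liftˡ (inj₁ x∈S)           = inj₁ x∈S
  liftˡ (inj₂ (w , eq , w∉)) = inj₂ (inˡ w , eq , w∉)

  visited : x ∈ visit S L → Goal
  visited x∈ with visit⁻ L x∈
  ... | inj₁ x∈S = inj₁ x∈S
  ... | inj₂ occ = liftˡ (first-occurrence S L occ)

  atRoot : x ∈ n ∷ visit S L → Goal
  atRoot (there x∈)  = visited x∈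
  atRoot (here refl) with x ∈? visit S L
  ... | yes x∈ = visited x∈
  ... | no  x∉ = inj₂ (root , refl , x∉)

  liftʳ : (x ∈ n ∷ visit S L ⊎ ∃ λ (w : Node R) → label w ≡ x × label w ∉ seen (n ∷ visit S L) w) → Goal
  liftʳ (inj₁ x∈)            = atRoot x∈
  liftʳ (inj₂ (w , eq , w∉)) = inj₂ (inʳ w , eq , w∉)

-- Recursive description of trees with prescribed blocks

module _ (B : ℕ → Multiset) where

  -- T is a subtree off the diagonal, and S lists the labels visited before it.
  data OffDiagonal (S : List ℕ) : LTree → Set where
    empty  : OffDiagonal S ∅
    branch : max L < n → max R ≤ n → (n ∉ visit S L ⇔ L ≢ ∅) → (L ≢ ∅ → rlabels L ↭ B n) →
             OffDiagonal S L → OffDiagonal (n ∷ visit S L) R → OffDiagonal S (node L n R)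

  -- T is the subtree at a node on the diagonal.
  data Diagonal : LTree → Set where
    empty  : Diagonal ∅
    branch : max L < n → max R ≤ n → n ∷ rlabels R ↭ B n →
             Diagonal L → OffDiagonal (n ∷ visit [] L) R → Diagonal (node L n R)

  -- `Diagonal` forces `n ∈ B n` for each diagonal label `n`, but does not fix which such labels
  -- appear. Uniqueness needs this converse: none up to `max T` is skipped.
  Complete : LTree → Set
  Complete T = ∀ {d} → d ∈ B d → d ∈[ max T ] → ∃ λ (v : Node T) → v ∈ lspine T × label v ≡ d

module _ {B : ℕ → Multiset} where

  -- `seen` computes along `inˡ` and `inʳ`, so the nodewise conditions restrict to the subtrees,
  -- with the visited list updated as in `branch`.
  offDiagonal⁺ : ∀ T → Decreasing T → StrictlyDecreasingLeft T →
    (∀ (v : Node T) → label v ∉ seen S v ⇔ leftOf v ≢ ∅) →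
    (∀ (v : Node T) → leftOf v ≢ ∅ → rlabels (leftOf v) ↭ B (label v)) →
    OffDiagonal B S T
  offDiagonal⁺ (leaf _) _ _ _ _ = empty
  offDiagonal⁺ (node L n R) (dL , dR , ≤n) (L<n , sL , sR) fresh blocks =
    branch L<n (≤-trans (m≤n⊔m (max L) _) ≤n) (fresh root) (blocks root)
      (offDiagonal⁺ L dL sL (fresh ∘ inˡ) (blocks ∘ inˡ))
      (offDiagonal⁺ R dR sR (fresh ∘ inʳ) (blocks ∘ inʳ))

  diagonal⁺ : ∀ T → Decreasing T → StrictlyDecreasingLeft T →
    (∀ (v : Node T) → label v ∉ seen [] v ⇔ Asc v) →
    (∀ (v : Node T) → Asc v → block v ↭ B (label v)) →
    Diagonal B T
  diagonal⁺ (leaf _) _ _ _ _ = empty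
  diagonal⁺ (node L n R) (dL , dR , ≤n) (L<n , sL , sR) fresh blocks =
    branch L<n (≤-trans (m≤n⊔m (max L) _) ≤n) (blocks root tt)
      (diagonal⁺ L dL sL (fresh ∘ inˡ) (blocks ∘ inˡ))
      (offDiagonal⁺ R dR sR (fresh ∘ inʳ) (blocks ∘ inʳ))

  offDiagonal-decreasing : OffDiagonal B S T → Decreasing T
  offDiagonal-decreasing empty = tt
  offDiagonal-decreasing (branch L<n R≤n _ _ oL oR) =
    offDiagonal-decreasing oL , offDiagonal-decreasing oR , ⊔-lub (<⇒≤ L<n) R≤n

  diagonal-decreasing : Diagonal B T → Decreasing T
  diagonal-decreasing empty = tt
  diagonal-decreasing (branch L<n R≤n _ dL oR) =
    diagonal-decreasing dL , offDiagonal-decreasing oR , ⊔-lub (<⇒≤ L<n) R≤n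

  offDiagonal-strict : OffDiagonal B S T → StrictlyDecreasingLeft T
  offDiagonal-strict empty = tt
  offDiagonal-strict (branch L<n _ _ _ oL oR) = L<n , offDiagonal-strict oL , offDiagonal-strict oR

  diagonal-strict : Diagonal B T → StrictlyDecreasingLeft T
  diagonal-strict empty = tt
  diagonal-strict (branch L<n _ _ dL oR) = L<n , diagonal-strict dL , offDiagonal-strict oR

  offDiagonal-fresh : OffDiagonal B S T → (v : Node T) → label v ∉ seen S v ⇔ leftOf v ≢ ∅
  offDiagonal-fresh (branch _ _ fresh _ _ _) root    = fresh
  offDiagonal-fresh (branch _ _ _ _ oL _)    (inˡ v) = offDiagonal-fresh oL v
  offDiagonal-fresh (branch _ _ _ _ _ oR)    (inʳ v) = offDiagonal-fresh oR v

  diagonal-fresh : Diagonal B T → (v : Node T) → label v ∉ seen [] v ⇔ Asc v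
  -- Only `L` is visited before the root, and `max L < n`; so the root label is new, in accordance
  -- with `Asc root`.
  diagonal-fresh {node L n R} (branch L<n _ _ _ _) root = mk⇔ (λ _ → tt) λ _ n∈ → lemma (visit⁻ L n∈)
    where
    lemma : ¬ (n ∈ [] ⊎ Occurs n L)
    lemma (inj₂ occ) = <⇒≱ L<n (occurs≤max occ)
  diagonal-fresh (branch _ _ _ dL _) (inˡ v) = diagonal-fresh dL v
  diagonal-fresh (branch _ _ _ _ oR) (inʳ v) = offDiagonal-fresh oR v

  offDiagonal-blocks : OffDiagonal B S T → (v : Node T) → leftOf v ≢ ∅ → rlabels (leftOf v) ↭ B (label v)
  offDiagonal-blocks (branch _ _ _ L↭ _ _) root    = L↭
  offDiagonal-blocks (branch _ _ _ _ oL _) (inˡ v) = offDiagonal-blocks oL v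
  offDiagonal-blocks (branch _ _ _ _ _ oR) (inʳ v) = offDiagonal-blocks oR v

  diagonal-blocks : Diagonal B T → (v : Node T) → Asc v → block v ↭ B (label v)
  diagonal-blocks (branch _ _ B↭ _ _) root    _ = B↭
  diagonal-blocks (branch _ _ _ dL _) (inˡ v)   = diagonal-blocks dL v
  diagonal-blocks (branch _ _ _ _ oR) (inʳ v)   = offDiagonal-blocks oR v

  -- The maximum is the head of the right path, or 0 for the empty tree. The predicate `P` covers
  -- strict and weak bounds alike.
  max-offDiagonal : ∀ {P : ℕ → Set} → OffDiagonal B S T → P 0 → All P (rlabels T) → P (max T)
  max-offDiagonal empty p0 _ = p0
  max-offDiagonal {P = P} (branch {L = L} {R = R} L<n R≤n _ _ _ _) _ (pn ∷ _) =
    subst P (sym (max-node L R L<n R≤n)) pn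

  -- Uniqueness of trees with prescribed blocks

  -- A head dominates its right path, so permuted right paths have equal heads `n`. Whether `n` is
  -- new decides if the left subtrees are empty; if not, both carry `B n`. Once they agree, the
  -- right subtrees start from the same visited list.
  offDiagonal-unique : OffDiagonal B S T → OffDiagonal B S T′ → rlabels T ↭ rlabels T′ → T ≡ T′
  offDiagonal-unique empty empty _ = refl
  offDiagonal-unique empty (branch _ _ _ _ _ _) p = contradiction (↭-sym p) ¬x∷xs↭[]
  offDiagonal-unique (branch _ _ _ _ _ _) empty p = contradiction p ¬x∷xs↭[]
  offDiagonal-unique {S} {node L n R} {node L′ n′ R′}
    (branch L<n R≤n fresh L↭ oL oR) (branch L<n′ R≤n′ fresh′ L↭′ oL′ oR′) p
    with ≤-antisym (rlabels-head≤ {R = R′} R≤n′ (∈-resp-↭ p (here refl)))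
                   (rlabels-head≤ {R = R} R≤n (∈-resp-↭ (↭-sym p) (here refl)))
  ... | refl with left-unique oL oL′ fresh fresh′ L↭ L↭′
    where
    left-unique : ∀ {L L′} → OffDiagonal B S L → OffDiagonal B S L′ →
      (n ∉ visit S L ⇔ L ≢ ∅) → (n ∉ visit S L′ ⇔ L′ ≢ ∅) →
      (L ≢ ∅ → rlabels L ↭ B n) → (L′ ≢ ∅ → rlabels L′ ↭ B n) → L ≡ L′
    left-unique empty empty _ _ _ _ = refl
    -- If `n` is missing from `visit S L′`, it is missing from `S`, which is incompatible with an
    -- empty left subtree.
    left-unique {L′ = L′} empty (branch _ _ _ _ _ _) fresh fresh′ _ _ =
      contradiction refl (to fresh (from fresh′ (λ ()) ∘ visit⁺ˡ L′))
    left-unique {L} (branch _ _ _ _ _ _) empty fresh fresh′ _ _ =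
      contradiction refl (to fresh′ (from fresh (λ ()) ∘ visit⁺ˡ L))
    left-unique oL@(branch _ _ _ _ _ _) oL′@(branch _ _ _ _ _ _) _ _ L↭ L↭′ =
      offDiagonal-unique oL oL′ (↭-trans (L↭ λ ()) (↭-sym (L↭′ λ ())))
  ... | refl = cong (node L n) (offDiagonal-unique oR oR′ (drop-∷ p))

  diagonal-max : Diagonal B T → max T ≡ 0 ⊎ max T ∈ B (max T)
  diagonal-max empty = inj₁ refl
  diagonal-max {node L _ R} (branch L<n R≤n B↭ _ _) rewrite max-node L R L<n R≤n = inj₂ (∈-resp-↭ B↭ (here refl))

  complete-left : max L < n → Complete B (node L n R) → Complete B L
  complete-left {L} {n} {R} L<n c d∈ (0<d , d≤) with c d∈ (0<d , ≤-trans d≤ (m≤n⇒m≤o⊔n n (m≤m⊔n (max L) (max R))))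
  ... | _ , here refl , refl = contradiction d≤ (<⇒≱ L<n)
  ... | _ , there v∈ , eq with ∈-map⁻ inˡ v∈
  ...   | v , v∈′ , refl = v , v∈′ , eq

  -- Here `T` is the left subtree of the competing tree. A positive `max T` lies in its own block
  -- and below `n`, so completeness puts it on the diagonal strictly under the root. Used in both
  -- directions, this equates the maxima of the two left subtrees.
  diagonal-max-left : Complete B (node L n R) → Diagonal B T → max T < n → max T ≤ max L
  diagonal-max-left {L} {n} {T = T} c dT T<n with diagonal-max dT
  ... | inj₁ eq = subst (_≤ max L) (sym eq) z≤n
  ... | inj₂ m∈ with max T ℕ.≟ 0
  ...   | yes eq = subst (_≤ max L) (sym eq) z≤n
  ...   | no  m≢0 with c m∈ (n≢0⇒n>0 m≢0 , ≤-trans (<⇒≤ T<n) (m≤m⊔n n _))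
  ...     | _ , here refl , eq = contradiction eq (>⇒≢ T<n)
  ...     | _ , there v∈ , eq with ∈-map⁻ inˡ v∈
  ...       | v , _ , refl = subst (_≤ max L) eq (label≤max v)

  -- The maximum is the root label, and completeness passes equality of maxima on to the left
  -- subtrees, so the induction runs down the diagonal. The right subtrees then share the visited
  -- list and the rest of `B n`.
  diagonal-unique : Diagonal B T → Diagonal B T′ → Complete B T → Complete B T′ →
                    max T ≡ max T′ → T ≡ T′
  diagonal-unique empty empty _ _ _ = refl
  diagonal-unique empty (branch {L = L} {R = R} L<n R≤n _ _ _) _ _ eq =
    contradiction (subst (max L <_) (sym (trans eq (max-node L R L<n R≤n))) L<n) λ ()
  diagonal-unique (branch {L = L} {R = R} L<n R≤n _ _ _) empty _ _ eq =
    contradiction (subst (max L <_) (trans (sym (max-node L R L<n R≤n)) eq) L<n) λ ()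
  diagonal-unique {node L n R} {node L′ n′ R′}
    (branch L<n R≤n B↭ dL oR) (branch L<n′ R≤n′ B↭′ dL′ oR′) c c′ eq
    with trans (sym (max-node L R L<n R≤n)) (trans eq (max-node L′ R′ L<n′ R≤n′))
  ... | refl with diagonal-unique dL dL′ (complete-left {R = R} L<n c) (complete-left {R = R′} L<n′ c′)
                    (≤-antisym (diagonal-max-left {R = R′} c′ dL L<n) (diagonal-max-left {R = R} c dL′ L<n′))
  ...   | refl = cong (node L n) (offDiagonal-unique oR oR′ (drop-∷ (↭-trans B↭ (↭-sym B↭′))))

-- Existence: building a tree from its blocks

decreasing-head : ∀ {xs} → AllPairs _≥_ xs → x ∈ xs → (∀ {y} → y ∈ xs → y ≤ x) → ∃ λ ys → xs ≡ x ∷ ys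
decreasing-head (_ ∷ _)  (here refl) _  = _ , refl
decreasing-head (y≥ ∷ _) (there x∈)  ≤x = _ , cong (_∷ _) (≤-antisym (≤x (here refl)) (All.lookup y≥ x∈))

-- The cover conditions with blocks indexed by natural numbers, so that a label names its block
-- without a range proof.
record IsBlockFamily (k : ℕ) (B : ℕ → Multiset) : Set where
  field
    nonempty : n ∈[ k ] → B n ≢ []
    bounded  : x ∈ B n → x ∈[ k ] × x ≤ n
    support  : x ∈[ k ] → ∃ λ n → n ∈[ k ] × x ∈ B n

module _ {B : ℕ → Multiset} (F : IsBlockFamily k B) where
  open IsBlockFamily F

  private
    ∈-sort⁻ : ∀ n → x ∈ sort (B n) → x ∈ B n
    ∈-sort⁻ n = ∈-resp-↭ (sort-↭ (B n))

    ∈-sort⁺ : ∀ n → x ∈ B n → x ∈ sort (B n)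
    ∈-sort⁺ n = ∈-resp-↭ (↭-sym (sort-↭ (B n)))

    sort-decreasing : ∀ n → AllPairs _≥_ (sort (B n))
    sort-decreasing n = Linked⇒AllPairs (λ p q → ≤-trans q p) (sort-↗ (B n))

  -- The bound `m` is the recursion measure for descending into left subtrees. The last hypothesis
  -- says that the diagonal labels below `m` have been visited, so a new label below `m` cannot lie
  -- in its own block.
  Buildable : ℕ → Set
  Buildable m = ∀ S xs → AllPairs _≥_ xs → All (_< m) xs → All (_∈[ k ]) xs →
    (∀ {d} → d ∈ B d → d < m → d ∈ S) → ∃ λ T → OffDiagonal B S T × rlabels T ≡ xs

  -- The left subtree of a node labeled x is built from B x, whose elements
  -- are less than x because a new label x off the diagonal satisfies x ∉ B x.
  buildable-suc : ∀ {m} → Buildable m → Buildable (suc m)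
  buildable-suc _ S [] _ _ _ _ = ∅ , empty , refl
  buildable-suc build S (x ∷ xs) (x≥ ∷ xs≥) (x<1+m ∷ xs<1+m) (x∈[k] ∷ xs∈[k]) diag∈S
    with x ∈? S
  -- A label seen before gets an empty left subtree, and only the right path continues.
  ... | yes x∈S
    with buildable-suc build (x ∷ S) xs xs≥ xs<1+m xs∈[k] (λ d∈ d<1+m → there (diag∈S d∈ d<1+m))
  ...   | R , oR , refl =
    node ∅ x R ,
    branch (proj₁ x∈[k]) (max-offDiagonal oR z≤n x≥)
      (mk⇔ (contradiction x∈S) (contradiction refl)) (contradiction refl) empty oR ,
    refl
  buildable-suc build S (x ∷ xs) (x≥ ∷ xs≥) (x<1+m ∷ xs<1+m) (x∈[k] ∷ xs∈[k]) diag∈S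
    | no x∉S =
    node T₁ x T₂ ,
    branch T₁<x (max-offDiagonal o₂ z≤n (subst (All (_≤ x)) (sym eq₂) x≥))
      (mk⇔ (λ _ → T₁≢∅) (λ _ → x∉)) (λ _ → T₁↭) o₁ o₂ ,
    cong (x ∷_) eq₂
    where
    B<x : ∀ {y} → y ∈ B x → y < x
    B<x y∈ = ≤∧≢⇒< (proj₂ (bounded y∈)) λ { refl → x∉S (diag∈S y∈ x<1+m) }

    left : ∃ λ T → OffDiagonal B S T × rlabels T ≡ sort (B x)
    left = build S (sort (B x)) (sort-decreasing x)
      -- The elements of `B x` are below `x ≤ m`, so the bound drops from `suc m` to `m`.
      (All.tabulate λ y∈ → ≤-trans (B<x (∈-sort⁻ x y∈)) (s≤s⁻¹ x<1+m))
      (All.tabulate (proj₁ ∘ bounded ∘ ∈-sort⁻ x))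
      (λ d∈ d<m → diag∈S d∈ (m<n⇒m<1+n d<m))

    T₁ = proj₁ left
    o₁ = proj₁ (proj₂ left)

    right : ∃ λ T → OffDiagonal B (x ∷ visit S T₁) T × rlabels T ≡ xs
    right = buildable-suc build (x ∷ visit S T₁) xs xs≥ xs<1+m xs∈[k]
      (λ d∈ d<1+m → there (visit⁺ˡ T₁ (diag∈S d∈ d<1+m)))

    T₂  = proj₁ right
    o₂  = proj₁ (proj₂ right)
    eq₂ = proj₂ (proj₂ right)

    T₁↭ : rlabels T₁ ↭ B x
    T₁↭ = ↭-trans (↭-reflexive (proj₂ (proj₂ left))) (sort-↭ (B x))

    T₁≢∅ : T₁ ≢ ∅
    T₁≢∅ eq = nonempty x∈[k] (↭-empty-inv (↭-sym (subst (λ T → rlabels T ↭ B x) eq T₁↭)))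

    T₁<x : max T₁ < x
    T₁<x = max-offDiagonal o₁ (proj₁ x∈[k]) (All.tabulate (B<x ∘ ∈-resp-↭ T₁↭))

    x∉ : x ∉ visit S T₁
    x∉ x∈ with visit⁻ T₁ x∈
    ... | inj₁ x∈S = x∉S x∈S
    ... | inj₂ occ = <⇒≱ T₁<x (occurs≤max occ)

  buildable : ∀ m → Buildable m
  buildable zero    S []       _ _        _ _ = ∅ , empty , refl
  buildable zero    S (_ ∷ _)  _ (() ∷ _) _ _
  buildable (suc m) = buildable-suc (buildable m)

  offDiagonal-labels : OffDiagonal B S T → (∀ {x} → x ∈ rlabels T → x ∈[ k ]) →
                       (v : Node T) → label v ∈[ k ]
  offDiagonal-labels (branch _ _ _ _ _ _) T∈ root = T∈ (here refl)
  offDiagonal-labels {T = node (node _ _ _) _ _} (branch _ _ _ L↭ oL _) _ (inˡ v) =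
    offDiagonal-labels oL (proj₁ ∘ bounded ∘ ∈-resp-↭ (L↭ λ ())) v
  offDiagonal-labels (branch _ _ _ _ _ oR) T∈ (inʳ v) = offDiagonal-labels oR (T∈ ∘ there) v

  diagonal-labels : Diagonal B T → (v : Node T) → label v ∈[ k ]
  diagonal-labels (branch _ _ B↭ _ _) root    = proj₁ (bounded (∈-resp-↭ B↭ (here refl)))
  diagonal-labels (branch _ _ _ dL _) (inˡ v) = diagonal-labels dL v
  diagonal-labels (branch _ _ B↭ _ oR) (inʳ v) =
    offDiagonal-labels oR (proj₁ ∘ bounded ∘ ∈-resp-↭ B↭ ∘ there) v

  -- Stage `suc n` adds a root exactly if `suc n ∈ B (suc n)`, with the previous tree on its left.
  -- `max T ≤ n` gives the strict decrease, and the last component the visited diagonal labels that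
  -- `Buildable` asks for.
  diagonal-exists : ∀ n → ∃ λ T → Diagonal B T × max T ≤ n × (∀ {d} → d ∈ B d → d ≤ n → Occurs d T)
  diagonal-exists zero = ∅ , empty , z≤n , λ { d∈ z≤n → contradiction (proj₁ (proj₁ (bounded d∈))) λ () }
  diagonal-exists (suc n) with diagonal-exists n | suc n ∈? B (suc n)
  ... | T , dT , T≤n , diag | no 1+n∉ = T , dT , m≤n⇒m≤1+n T≤n , diag′
    where
    diag′ : ∀ {d} → d ∈ B d → d ≤ suc n → Occurs d T
    diag′ d∈ d≤ with m≤n⇒m<n∨m≡n d≤
    ... | inj₁ d<1+n = diag d∈ (s≤s⁻¹ d<1+n)
    ... | inj₂ refl  = contradiction d∈ 1+n∉
  ... | T , dT , T≤n , diag | yes 1+n∈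
    with decreasing-head (sort-decreasing (suc n)) (∈-sort⁺ (suc n) 1+n∈) (proj₂ ∘ bounded ∘ ∈-sort⁻ (suc n))
  ...   | xs , eq =
    node T (suc n) T₂ ,
    branch (s≤s T≤n) T₂≤1+n (subst (λ xs → suc n ∷ xs ↭ B (suc n)) (sym eq₂) sorted↭) dT o₂ ,
    ≤-reflexive (max-node T T₂ (s≤s T≤n) T₂≤1+n) ,
    λ d∈ d≤ → occurs (diag′ d∈ (s≤s d≤))
    where
    sorted≥ : AllPairs _≥_ (suc n ∷ xs)
    sorted≥ = subst (AllPairs _≥_) eq (sort-decreasing (suc n))

    sorted↭ : suc n ∷ xs ↭ B (suc n)
    sorted↭ = subst (_↭ B (suc n)) eq (sort-↭ (B (suc n)))

    diag′ : ∀ {d} → d ∈ B d → d < suc (suc n) → d ∈ suc n ∷ visit [] T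
    diag′ d∈ d<2+n with m≤n⇒m<n∨m≡n (s≤s⁻¹ d<2+n)
    ... | inj₂ refl = here refl
    ... | inj₁ d<1+n with diag d∈ (s≤s⁻¹ d<1+n)
    ...   | v , refl = there (visit⁺ʳ v)

    right : ∃ λ R → OffDiagonal B (suc n ∷ visit [] T) R × rlabels R ≡ xs
    -- The rest `xs` of the block may repeat `suc n`, so the strict bound is `suc (suc n)`.
    right = buildable (suc (suc n)) (suc n ∷ visit [] T) xs (AllPairs.tail sorted≥)
      (All.map s≤s (AllPairs.head sorted≥))
      (All.tabulate (proj₁ ∘ bounded ∘ ∈-resp-↭ sorted↭ ∘ there)) diag′

    T₂  = proj₁ right
    o₂  = proj₁ (proj₂ right)
    eq₂ = proj₂ (proj₂ right)

    T₂≤1+n : max T₂ ≤ suc n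
    T₂≤1+n = max-offDiagonal o₂ z≤n (subst (All (_≤ suc n)) (sym eq₂) (AllPairs.head sorted≥))

    occurs : ∀ {d} → d ∈ suc n ∷ visit [] T → Occurs d (node T (suc n) T₂)
    occurs (here refl) = root , refl
    occurs (there d∈) with visit⁻ T d∈
    ... | inj₂ (v , eq) = inˡ v , eq

  -- The first node labeled `x` is an ascent top, so its block realizes all of `B x` inside `T`.
  diagonal-closed : Diagonal B T → Occurs x T → y ∈ B x → Occurs y T
  diagonal-closed {T} d occ y∈ with first-occurrence [] T occ
  ... | inj₂ (w , refl , w∉) =
    block-occurs w (∈-resp-↭ (↭-sym (diagonal-blocks d w (to (diagonal-fresh d w) w∉))) y∈)

  -- Descending induction on i, with e bounding k - i.
  diagonal-all-occur : Diagonal B T → (∀ {d} → d ∈ B d → d ≤ k → Occurs d T) →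
                       ∀ e {i} → k ≤ e + i → i ∈[ k ] → Occurs i T
  diagonal-all-occur d diag e {i} k≤ i∈[k] with support i∈[k]
  -- Either `i ∈ B i` is a diagonal label, or `i` lies in the block of a larger `n`, which occurs by
  -- induction.
  ... | n , n∈[k] , i∈ with m≤n⇒m<n∨m≡n (proj₂ (bounded i∈))
  ...   | inj₂ refl = diag i∈ (proj₂ i∈[k])
  diagonal-all-occur d diag zero    k≤ i∈[k] | n , n∈[k] , i∈ | inj₁ i<n =
    contradiction (≤-trans i<n (≤-trans (proj₂ n∈[k]) k≤)) (n≮n _)
  diagonal-all-occur d diag (suc e) {i} k≤ i∈[k] | n , n∈[k] , i∈ | inj₁ i<n =
    diagonal-closed d (diagonal-all-occur d diag e k≤e+n n∈[k]) i∈
    where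
    k≤e+n : k ≤ e + n
    k≤e+n = ≤-trans k≤ (≤-trans (≤-reflexive (sym (+-suc e i))) (+-monoʳ-≤ e i<n))

  diagonal-max≡ : Diagonal B T → (∀ {i} → i ∈[ k ] → Occurs i T) → max T ≡ k
  diagonal-max≡ {T} d occ = ≤-antisym T≤k (k≤T k refl)
    where
    T≤k : max T ≤ k
    T≤k with diagonal-max d
    ... | inj₁ eq = subst (_≤ k) (sym eq) z≤n
    ... | inj₂ m∈ = proj₂ (proj₁ (bounded m∈))

    -- The copy `j` allows a case split on the module parameter `k`.
    k≤T : ∀ j → j ≡ k → j ≤ max T
    k≤T zero    _    = z≤n
    k≤T (suc j) refl = occurs≤max (occ (z<s , ≤-refl))

  diagonal-fishburn : Diagonal B T → (∀ {i} → i ∈[ k ] → Occurs i T) → IsFishburnTree T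
  diagonal-fishburn {T} d occ = record
    { isEndotree = record
      { decreasing         = diagonal-decreasing d
      ; strictlyDecreasing = diagonal-strict d
      ; labels∈[size]      = λ v → let 1≤ , ≤k = diagonal-labels d v in 1≤ , ≤-trans ≤k k≤#nodes
      }
    ; regular     = k , k≤#nodes , λ i → mk⇔ (λ { (v , refl) → diagonal-labels d v }) occ
    ; nub≐asctops =
      (λ {v} nub → Asc⇒AscTop v (to (diagonal-fresh d v) (Nub⇒∉seen v nub))) ,
      (λ {v} top → ∉seen⇒Nub v (from (diagonal-fresh d v) (AscTop⇒Asc v top)))
    }
    where
    k≤#nodes : k ≤ #nodes T
    k≤#nodes = all-occur⇒≤#nodes occ

-- Covers as block families

infix 9 _⟨_⟩

-- The block B_i of B_1 … B_k, and [] for i outside [k].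
_⟨_⟩ : List Multiset → ℕ → Multiset
[]      ⟨ _ ⟩           = []
(_ ∷ _) ⟨ zero ⟩        = []
(X ∷ _) ⟨ suc zero ⟩    = X
(_ ∷ P) ⟨ suc (suc i) ⟩ = P ⟨ suc i ⟩

lookup-⟨⟩ : ∀ P (i : Fin (length P)) → P ⟨ suc (toℕ i) ⟩ ≡ lookup P i
lookup-⟨⟩ (_ ∷ _) zero    = refl
lookup-⟨⟩ (_ ∷ P) (suc i) = lookup-⟨⟩ P i

∈-⟨⟩ : ∀ P n → x ∈ P ⟨ n ⟩ → ∃ λ (i : Fin (length P)) → n ≡ suc (toℕ i)
∈-⟨⟩ (_ ∷ _) (suc zero)    _  = zero , refl
∈-⟨⟩ (_ ∷ P) (suc (suc n)) x∈ with ∈-⟨⟩ P (suc n) x∈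
... | i , eq = suc i , cong suc eq

≋-tabulate⁺ : ∀ {n} (f : Fin n → Multiset) P → n ≡ length P →
              (∀ i → f i ↭ P ⟨ suc (toℕ i) ⟩) → tabulate f ≋ P
≋-tabulate⁺ {zero}  f []      _  _  = []
≋-tabulate⁺ {suc n} f (_ ∷ P) eq f↭ = f↭ zero ∷ ≋-tabulate⁺ (f ∘ suc) P (suc-injective eq) (f↭ ∘ suc)

≋-tabulate⁻ : ∀ {n} (f : Fin n → Multiset) {P} → tabulate f ≋ P →
              n ≡ length P × (∀ i → f i ↭ P ⟨ suc (toℕ i) ⟩)
≋-tabulate⁻ {zero}  f []        = refl , λ ()
≋-tabulate⁻ {suc n} f (p ∷ ps) with ≋-tabulate⁻ (f ∘ suc) ps
... | eq , f↭ = cong suc eq , λ { zero → p ; (suc i) → f↭ i }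

cover-blockFamily : ∀ {P} → IsFishburnCover P → IsBlockFamily (length P) (P ⟨_⟩)
cover-blockFamily {P} cover = record
  { nonempty = nonempty′
  ; bounded  = bounded′
  ; support  = support′
  }
  where
  open IsFishburnCover cover

  nonempty′ : n ∈[ length P ] → P ⟨ n ⟩ ≢ []
  nonempty′ n∈ with ∈[]⇒toℕ n∈
  ... | i , refl = All.lookup nonempty (∈-lookup i) ∘ trans (sym (lookup-⟨⟩ P i))

  bounded′ : x ∈ P ⟨ n ⟩ → x ∈[ length P ] × x ≤ n
  bounded′ {n = n} x∈ with ∈-⟨⟩ P n x∈
  ... | i , refl = to (support _) (i , x∈′) , bounded i x∈′
    where x∈′ = subst (_ ∈_) (lookup-⟨⟩ P i) x∈

  support′ : x ∈[ length P ] → ∃ λ n → n ∈[ length P ] × x ∈ P ⟨ n ⟩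
  support′ x∈ with from (support _) x∈
  ... | i , x∈′ = suc (toℕ i) , (z<s , Fin.toℕ<n i) , subst (_ ∈_) (sym (lookup-⟨⟩ P i)) x∈′

-- From Fishburn trees and `𝔓` to the recursive description

module _ (F : IsFishburnTree T) where
  open IsFishburnTree F
  open IsEndotree isEndotree

  fishburn-fresh : (v : Node T) → label v ∉ seen [] v ⇔ Asc v
  fishburn-fresh v = mk⇔ (AscTop⇒Asc v ∘ proj₁ nub≐asctops ∘ ∉seen⇒Nub v)
                         (Nub⇒∉seen v ∘ proj₂ nub≐asctops ∘ Asc⇒AscTop v)

  𝔓-≋⁺ : ∀ {P} → max T ≡ length P → (∀ (v : Node T) → Asc v → block v ↭ P ⟨ label v ⟩) → 𝔓 T F ≋ P
  𝔓-≋⁺ {P} eq blocks = ≋-tabulate⁺ _ P eq λ i →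
    let v , (top , label≡) , _ = asctops-transversal F (s≤s z≤n , Fin.toℕ<n i) in
    ↭-trans (↭-reflexive (map-label-W v))
      (subst (λ l → block v ↭ P ⟨ l ⟩) label≡ (blocks v (AscTop⇒Asc v top)))

  -- By uniqueness in `asctops-transversal`, each ascent top is the representative chosen by `𝔓` for
  -- its label, so the blockwise permutations speak about all ascent tops.
  𝔓-≋⁻ : ∀ {P} → 𝔓 T F ≋ P → max T ≡ length P × (∀ (v : Node T) → Asc v → block v ↭ P ⟨ label v ⟩)
  𝔓-≋⁻ {P} 𝔓≋P with ≋-tabulate⁻ _ 𝔓≋P
  ... | eq , W↭ = eq , λ v a → blocks v a (∈[]⇒toℕ (proj₁ (labels∈[size] v) , label≤max v))
    where
    blocks : (v : Node T) → Asc v → ∃ (λ (i : Fin (max T)) → suc (toℕ i) ≡ label v) →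
             block v ↭ P ⟨ label v ⟩
    blocks v a (i , i≡) with asctops-transversal F (s≤s z≤n , Fin.toℕ<n i) | W↭ i
    ... | _ , _ , unique | W↭ᵢ with unique (Asc⇒AscTop v a , sym i≡)
    ...   | refl = subst (λ l → block v ↭ P ⟨ l ⟩) i≡
      (↭-trans (↭-reflexive (sym (map-label-W v))) W↭ᵢ)

  -- If the ascent top labeled `d` were off the diagonal, its block would come from its left subtree
  -- and contain `d`, against strict decrease to the left.
  fishburn-complete : ∀ {B} → (∀ (v : Node T) → Asc v → block v ↭ B (label v)) → Complete B T
  fishburn-complete blocks {d} d∈ d∈[] with asctops-transversal F d∈[]
  ... | v , (top , refl) , _ with v ∈ᵀ? lspine T
    where open DecMembership (Defs._≟_ {T}) renaming (_∈?_ to _∈ᵀ?_)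
  ...   | yes v∈ = v , v∈ , refl
  ...   | no  v∉ = contradiction (occurs≤max (rlabels-occur (leftOf v) d∈′)) (<⇒≱ (max-leftOf< strictlyDecreasing v))
    where
    d∈′ : label v ∈ rlabels (leftOf v)
    d∈′ = subst (label v ∈_) (block-offdiag v v∉)
            (∈-resp-↭ (↭-sym (blocks v (AscTop⇒Asc v top))) d∈)

fishburn-unique : ∀ {P} (F : IsFishburnTree T) (F′ : IsFishburnTree T′) →
                  𝔓 T F ≋ P → 𝔓 T′ F′ ≋ P → T ≡ T′
fishburn-unique {P = P} F F′ 𝔓≋P 𝔓′≋P with 𝔓-≋⁻ F 𝔓≋P | 𝔓-≋⁻ F′ 𝔓′≋P
... | max≡ , blocks | max≡′ , blocks′ =
  diagonal-unique (diagonal F blocks) (diagonal F′ blocks′)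
    (fishburn-complete F {P ⟨_⟩} blocks) (fishburn-complete F′ {P ⟨_⟩} blocks′) (trans max≡ (sym max≡′))
  where
  diagonal : ∀ {T B} (F : IsFishburnTree T) → (∀ (v : Node T) → Asc v → block v ↭ B (label v)) →
             Diagonal B T
  diagonal {T} F = diagonal⁺ T decreasing strictlyDecreasing (fishburn-fresh F)
    where
    open IsFishburnTree F
    open IsEndotree isEndotree

theorem3p9 : (P : List Multiset) → IsFishburnCover P →
    ∃! _≡_ λ (T : LTree) → Σ (IsFishburnTree T) λ F → 𝔓 T F ≋ P
theorem3p9 P cover with diagonal-exists (cover-blockFamily cover) (length P)
... | T , d , _ , diag =
  T , (F , 𝔓≋P) , λ (F′ , 𝔓′≋P) → fishburn-unique F F′ 𝔓≋P 𝔓′≋P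
  where
  blockFamily = cover-blockFamily cover

  occ : ∀ {i} → i ∈[ length P ] → Occurs i T
  -- `length P ≤ length P + i` makes `length P` a sufficient induction bound for every `i`.
  occ = diagonal-all-occur blockFamily d diag (length P) (m≤m+n _ _)

  F : IsFishburnTree T
  F = diagonal-fishburn blockFamily d occ

  𝔓≋P : 𝔓 T F ≋ P
  𝔓≋P = 𝔓-≋⁺ F (diagonal-max≡ blockFamily d occ) (diagonal-blocks d)
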